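{- Let $n\geq 1$ and $s \in \{1,2\}$. If $\mathcal{A} \subset 2^{[n]}$ is a collection of even-sized subsets of $[n]$ with $|\mathcal{A}| \geq 2^{\lfloor n/2 \rfloor}+s$, then $\mathrm{op}(\mathcal{A}) \geq s \cdot 2^{\lfloor n/2 \rfloor-1}$.
   Context: $[n]=\{1,\ldots,n\}$ and $2^{[n]}$ denotes the collection of all subsets of $[n]$. For a collection $\mathcal{A}$ of sets, $\mathrm{op}(\mathcal{A})$ denotes the number of unordered pairs of distinct sets $A,B\in\mathcal{A}$ for which $|A\cap B|$ is odd. -}

module Defs where

open import Data.Nat using (ℕ; zero; suc; _+_)
open import Data.Nat.Base using (_%_)
open import Data.Bool using (Bool; true; false; if_then_else_)
open import Data.List using (List; []; _∷_)
open import Data.Fin.Subset using (Subset; _∩_; ∣_∣)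
open import Relation.Binary.PropositionalEquality using (_≡_)

EvenSize : ∀ {n} → Subset n → Set
EvenSize A = ∣ A ∣ % 2 ≡ 0

oddInter : ∀ {n} → Subset n → Subset n → ℕ
oddInter A B = ∣ A ∩ B ∣ % 2

countOdd : ∀ {n} → Subset n → List (Subset n) → ℕ
countOdd A [] = 0
countOdd A (B ∷ Bs) = oddInter A B + countOdd A Bs

-- op(𝒜): number of unordered pairs {A,B} (distinct positions in a
-- duplicate-free list enumerating 𝒜) with |A ∩ B| odd
op : ∀ {n} → List (Subset n) → ℕ
op [] = 0
op (A ∷ As) = countOdd A As + op As

{-# OPTIONS --safe #-}
module Submission where

-- Put K = 2^⌊n/2⌋ and join two sets by an edge when their intersection is odd. For the form
-- |x ∩ y| mod 2 the even sets are isotropic vectors, and every isotropic subspace has size at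
-- most K. The proof is by induction on log K, passing from a space V to u^⊥ / u.
--
-- If the whole family lies in z^⊥ for some z ≠ 0, it becomes a family with weights 0, 1, 2 in
-- z^⊥ / z. The edge count is multilinear in the weights, so it is smallest when at most one
-- weight equals 1, and the induction hypothesis for s = 1 suffices.
--
-- s = 1: if there are too few edges, two vertices x and y are isolated; take z = x + y.
--
-- s = 2: a vertex of degree at least K/2 can be deleted, leaving s = 1; two isolated vertices
-- give z = x + y as before. Otherwise there is a leaf u, with neighbour v. The family without v
-- lies in u^⊥, and v is adjacent to exactly one of x and x + u, so v has at least as many
-- neighbours as there are points of weight 2 in u^⊥ / u. If these are few, the support in
-- u^⊥ / u is large and has many edges by induction.

open import Defs
open import Data.Nat using (ℕ; _+_; _*_; _^_; _≤_; _∸_)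
open import Data.Nat.Base using (_/_)
open import Data.List using (List; length)
open import Data.List.Relation.Unary.All using (All)
open import Data.List.Relation.Unary.Unique.Propositional using (Unique)
open import Data.Fin.Subset using (Subset)
open import Data.Sum using (_⊎_)
open import Relation.Binary.PropositionalEquality using (_≡_)

open import Data.Bool using (Bool; true; false; not; _∧_; _xor_)
open import Data.Bool.Properties using (xor-assoc; xor-comm; xor-same; xor-identityʳ; ∧-distribʳ-xor; ∧-comm; ∧-zeroʳ)
import Data.Bool as Bool
open import Data.Empty using (⊥-elim)
open import Data.Fin using (Fin; combine; remQuot)
open import Data.Fin.Properties using (combine-injective; combine-remQuot; injective⇒≤; 2↔Bool)
open import Data.Fin.Subset using (_∩_; ∣_∣)
open import Data.Fin.Subset.Properties using (∩-comm; ∩-idem)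
open import Data.List using ([]; _∷_; _++_; map)
open import Data.List.Properties using (length-++; length-map)
open import Data.List.Membership.Propositional using (_∈_; find)
open import Data.List.Membership.Propositional.Properties using (∈-∃++)
open import Data.List.Relation.Binary.Permutation.Propositional using (_↭_; refl; prep; swap; trans; ↭-sym; ↭-trans; ↭⇒↭ₛ)
open import Data.List.Relation.Binary.Permutation.Propositional.Properties using (All-resp-↭; ↭-length; shift; map⁺; ++⁺ˡ; ++-comm)
import Data.List.Relation.Binary.Permutation.Setoid.Properties as PermSetoid
open import Data.List.Relation.Binary.Pointwise using (Pointwise; []; _∷_)
import Data.List.Relation.Binary.Pointwise as Pointwise
open import Data.List.Relation.Unary.All using ([]; _∷_; lookup)
import Data.List.Relation.Unary.All as All
import Data.List.Relation.Unary.All.Properties as AllP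
open import Data.List.Relation.Unary.AllPairs using (AllPairs; []; _∷_)
import Data.List.Relation.Unary.AllPairs as AllPairs
open import Data.List.Relation.Unary.Any using (Any; here; there; any?)
open import Data.Nat using (zero; suc; _<_; _%_; z≤n; s≤s; s≤s⁻¹; _≤?_; _<?_)
open import Data.Nat.DivMod using (%-distribˡ-+; m≡m%n+[m/n]*n; m%n<n)
open import Data.Nat.ListAction using (sum)
open import Data.Nat.ListAction.Properties using (sum-↭)
open import Data.Nat.Properties
open import Data.Nat.Tactic.RingSolver using (solve-∀)
open import Data.Product using (Σ; ∃; ∃₂; _×_; _,_; proj₁; proj₂)
open import Data.Sum using (inj₁; inj₂; [_,_]′)
open import Data.Unit using (⊤; tt)
open import Data.Vec using (Vec; []; _∷_; zipWith; replicate)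
open import Data.Vec.Properties using (zipWith-assoc; zipWith-comm; ≡-dec; ∷-injective)
open import Function using (_∘_; id; Inverse; Injection)
open import Function.Properties.Inverse using (↔-sym; ↔⇒↣)
open import Relation.Binary.PropositionalEquality using (_≢_; refl; sym; cong; cong₂; subst; subst₂; module ≡-Reasoning; resp₂; setoid)
import Relation.Binary.PropositionalEquality as Eq
open import Relation.Nullary using (¬_; Dec; yes; no)
open import Relation.Nullary.Decidable using (_⊎-dec_)

private
  variable
    n : ℕ

-- Subsets of [n] as vectors over the two-element field

infixl 6 _⊕_

_⊕_ : Subset n → Subset n → Subset n
_⊕_ = zipWith _xor_

𝟎 : Subset n
𝟎 = replicate _ false

⊕-comm : (x y : Subset n) → x ⊕ y ≡ y ⊕ x
⊕-comm = zipWith-comm xor-comm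

⊕-assoc : (x y z : Subset n) → (x ⊕ y) ⊕ z ≡ x ⊕ (y ⊕ z)
⊕-assoc = zipWith-assoc xor-assoc

⊕-cancelʳ : (x u : Subset n) → (x ⊕ u) ⊕ u ≡ x
⊕-cancelʳ []      []      = refl
⊕-cancelʳ (a ∷ x) (b ∷ u) = cong₂ _∷_ (cancel a b) (⊕-cancelʳ x u)
  where
  cancel : ∀ a b → (a xor b) xor b ≡ a
  cancel a b = Eq.trans (xor-assoc a b b) (Eq.trans (cong (a xor_) (xor-same b)) (xor-identityʳ a))

⊕-cancelˡ : (u x : Subset n) → u ⊕ (u ⊕ x) ≡ x
⊕-cancelˡ u x = Eq.trans (⊕-comm u (u ⊕ x)) (Eq.trans (cong (_⊕ u) (⊕-comm u x)) (⊕-cancelʳ x u))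

⊕-telescope : (x y z : Subset n) → (x ⊕ y) ⊕ (y ⊕ z) ≡ x ⊕ z
⊕-telescope x y z = Eq.trans (⊕-assoc x y (y ⊕ z)) (cong (x ⊕_) (⊕-cancelˡ y z))

⊕-cancel-both : (x y u : Subset n) → (x ⊕ u) ⊕ (y ⊕ u) ≡ x ⊕ y
⊕-cancel-both x y u = Eq.trans (cong ((x ⊕ u) ⊕_) (⊕-comm y u)) (⊕-telescope x u y)

⊕-swapʳ : (x u y : Subset n) → (x ⊕ u) ⊕ y ≡ (x ⊕ y) ⊕ u
⊕-swapʳ x u y = Eq.trans (⊕-assoc x u y) (Eq.trans (cong (x ⊕_) (⊕-comm u y)) (sym (⊕-assoc x y u)))

xor≡false⇒≡ : ∀ a b → a xor b ≡ false → a ≡ b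
xor≡false⇒≡ false b    p = sym p
xor≡false⇒≡ true  true p = refl

⊕≡𝟎⇒≡ : (x y : Subset n) → x ⊕ y ≡ 𝟎 → x ≡ y
⊕≡𝟎⇒≡ []          []          _  = refl
⊕≡𝟎⇒≡ (a ∷ x) (b ∷ y) eq with ∷-injective eq
... | p , q = cong₂ _∷_ (xor≡false⇒≡ a b p) (⊕≡𝟎⇒≡ x y q)

𝟎⊕𝟎 : 𝟎 ⊕ 𝟎 ≡ 𝟎 {n}
𝟎⊕𝟎 {zero}  = refl
𝟎⊕𝟎 {suc n} = cong (false ∷_) 𝟎⊕𝟎

-- The symmetric bilinear form and intersection parities

dot : Subset n → Subset n → Bool
dot []      []      = false
dot (a ∷ x) (b ∷ y) = (a ∧ b) xor dot x y

bit : Bool → ℕ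
bit false = 0
bit true  = 1

dot-comm : (x y : Subset n) → dot x y ≡ dot y x
dot-comm []      []      = refl
dot-comm (a ∷ x) (b ∷ y) = cong₂ _xor_ (∧-comm a b) (dot-comm x y)

xor-interchange : ∀ a b c d → (a xor b) xor (c xor d) ≡ (a xor c) xor (b xor d)
xor-interchange a b c d = begin
  (a xor b) xor (c xor d) ≡⟨ xor-assoc a b (c xor d) ⟩
  a xor (b xor (c xor d)) ≡⟨ cong (a xor_) (sym (xor-assoc b c d)) ⟩
  a xor ((b xor c) xor d) ≡⟨ cong (λ e → a xor (e xor d)) (xor-comm b c) ⟩
  a xor ((c xor b) xor d) ≡⟨ cong (a xor_) (xor-assoc c b d) ⟩
  a xor (c xor (b xor d)) ≡⟨ sym (xor-assoc a c (b xor d)) ⟩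
  (a xor c) xor (b xor d) ∎
  where open ≡-Reasoning

dot-⊕ : (x y z : Subset n) → dot (x ⊕ y) z ≡ dot x z xor dot y z
dot-⊕ []      []      []      = refl
dot-⊕ (a ∷ x) (b ∷ y) (c ∷ z) = begin
  ((a xor b) ∧ c) xor dot (x ⊕ y) z               ≡⟨ cong₂ _xor_ (∧-distribʳ-xor c a b) (dot-⊕ x y z) ⟩
  ((a ∧ c) xor (b ∧ c)) xor (dot x z xor dot y z) ≡⟨ xor-interchange (a ∧ c) (b ∧ c) (dot x z) (dot y z) ⟩
  ((a ∧ c) xor dot x z) xor ((b ∧ c) xor dot y z) ∎
  where open ≡-Reasoning

dot-𝟎 : (x : Subset n) → dot x 𝟎 ≡ false
dot-𝟎 []      = refl
dot-𝟎 (a ∷ x) = cong₂ _xor_ (∧-zeroʳ a) (dot-𝟎 x)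

-- The bridge between the two views: edge counts use `oddInter`, while linearity arguments are made
-- with `dot`.
oddInter≡bit-dot : (x y : Subset n) → oddInter x y ≡ bit (dot x y)
oddInter≡bit-dot []          []          = refl
oddInter≡bit-dot (false ∷ x) (b ∷ y)     = oddInter≡bit-dot x y
oddInter≡bit-dot (true ∷ x)  (false ∷ y) = oddInter≡bit-dot x y
oddInter≡bit-dot (true ∷ x)  (true ∷ y)  = begin
  suc ∣ x ∩ y ∣ % 2              ≡⟨ %-distribˡ-+ 1 ∣ x ∩ y ∣ 2 ⟩
  suc (oddInter x y) % 2         ≡⟨ cong (λ k → suc k % 2) (oddInter≡bit-dot x y) ⟩
  suc (bit (dot x y)) % 2        ≡⟨ flip (dot x y) ⟩
  bit (not (dot x y))            ∎
  where
  open ≡-Reasoning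
  flip : ∀ b → suc (bit b) % 2 ≡ bit (not b)
  flip false = refl
  flip true  = refl

oddInter-comm : (x y : Subset n) → oddInter x y ≡ oddInter y x
oddInter-comm x y = cong (λ z → ∣ z ∣ % 2) (∩-comm x y)

dot≡false⇒oddInter≡0 : (x y : Subset n) → dot x y ≡ false → oddInter x y ≡ 0
dot≡false⇒oddInter≡0 x y eq = Eq.trans (oddInter≡bit-dot x y) (cong bit eq)

oddInter≡0⇒dot≡false : (x y : Subset n) → oddInter x y ≡ 0 → dot x y ≡ false
oddInter≡0⇒dot≡false x y eq with dot x y | oddInter≡bit-dot x y
... | false | _ = refl
... | true  | p with () ← Eq.trans (sym eq) p

oddInter-cong : (x y z : Subset n) → dot x z ≡ dot y z → oddInter x z ≡ oddInter y z
oddInter-cong x y z eq =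
  Eq.trans (oddInter≡bit-dot x z) (Eq.trans (cong bit eq) (sym (oddInter≡bit-dot y z)))

Isotropic : Subset n → Set
Isotropic x = dot x x ≡ false

evenSize⇒isotropic : (x : Subset n) → EvenSize x → Isotropic x
evenSize⇒isotropic x ev = oddInter≡0⇒dot≡false x x (Eq.trans (cong (λ z → ∣ z ∣ % 2) (∩-idem x)) ev)

-- The odd-intersection graph

countOdd-++ : (x : Subset n) (L M : List (Subset n)) → countOdd x (L ++ M) ≡ countOdd x L + countOdd x M
countOdd-++ x []      M = refl
countOdd-++ x (y ∷ L) M =
  Eq.trans (cong (oddInter x y +_) (countOdd-++ x L M)) (sym (+-assoc (oddInter x y) _ _))

countOdd-↭ : (x : Subset n) {L M : List (Subset n)} → L ↭ M → countOdd x L ≡ countOdd x M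
countOdd-↭ x refl         = refl
countOdd-↭ x (prep y p)   = cong (oddInter x y +_) (countOdd-↭ x p)
countOdd-↭ x (swap y z p) = Eq.trans (cong (λ k → oddInter x y + (oddInter x z + k)) (countOdd-↭ x p))
                                     (+-exchange (oddInter x y) (oddInter x z) _)
  where
  +-exchange : ∀ a b c → a + (b + c) ≡ b + (a + c)
  +-exchange = solve-∀
countOdd-↭ x (trans p q)  = Eq.trans (countOdd-↭ x p) (countOdd-↭ x q)

op-↭ : {L M : List (Subset n)} → L ↭ M → op L ≡ op M
op-↭ refl         = refl
op-↭ (prep x p)   = cong₂ _+_ (countOdd-↭ x p) (op-↭ p)
op-↭ {L = _ ∷ _ ∷ L} {M = _ ∷ _ ∷ M} (swap x y p)
  rewrite countOdd-↭ x p | countOdd-↭ y p | op-↭ p | oddInter-comm x y =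
  exchange (oddInter y x) (countOdd x M) (countOdd y M) (op M)
  where
  exchange : ∀ a b c d → a + b + (c + d) ≡ a + c + (b + d)
  exchange = solve-∀
op-↭ (trans p q)  = Eq.trans (op-↭ p) (op-↭ q)

op-++-≥ʳ : (L M : List (Subset n)) → op M ≤ op (L ++ M)
op-++-≥ʳ []      M = ≤-refl
op-++-≥ʳ (x ∷ L) M = ≤-trans (op-++-≥ʳ L M) (m≤n+m _ (countOdd x (L ++ M)))

isolated⇒oddInter≡0 : (x : Subset n) (L : List (Subset n)) → countOdd x L ≡ 0 → All (λ y → oddInter x y ≡ 0) L
isolated⇒oddInter≡0 x []      eq = []
isolated⇒oddInter≡0 x (y ∷ L) eq =
  m+n≡0⇒m≡0 (oddInter x y) eq ∷ isolated⇒oddInter≡0 x L (m+n≡0⇒n≡0 (oddInter x y) eq)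

oddInter≡0⇒isolated : (x : Subset n) (L : List (Subset n)) → All (λ y → oddInter x y ≡ 0) L → countOdd x L ≡ 0
oddInter≡0⇒isolated x []      []       = refl
oddInter≡0⇒isolated x (y ∷ L) (p ∷ ps) = cong₂ _+_ p (oddInter≡0⇒isolated x L ps)

op-isolated : (L : List (Subset n)) → All (λ x → countOdd x L ≡ 0) L → op L ≡ 0
op-isolated []      []         = refl
op-isolated (x ∷ L) (p ∷ ps) = cong₂ _+_
  (m+n≡0⇒n≡0 (oddInter x x) p)
  (op-isolated L (All.map (λ {y} → m+n≡0⇒n≡0 (oddInter y x)) ps))

-- Each vertex of `F` adds its own edges to the count, so a total that does not grow leaves no edge
-- from `F` to `W`.
op-++-≤⇒isolated : (F W : List (Subset n)) → op (F ++ W) ≤ op W → All (λ x → countOdd x W ≡ 0) F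
op-++-≤⇒isolated []      W le = []
op-++-≤⇒isolated (x ∷ F) W le =
  n≤0⇒n≡0 (≤-trans (m≤n+m (countOdd x W) (countOdd x F)) (subst (_≤ 0) (countOdd-++ x F W) deg≤0))
    ∷ op-++-≤⇒isolated F W (≤-trans (m≤n+m _ (countOdd x (F ++ W))) le)
  where
  deg≤0 : countOdd x (F ++ W) ≤ 0
  deg≤0 = +-cancelʳ-≤ (op (F ++ W)) _ 0 (≤-trans le (op-++-≥ʳ F W))

countOdd≡1⇒neighbour : (u : Subset n) (L : List (Subset n)) → countOdd u L ≡ 1 →
  ∃₂ λ v R → L ↭ v ∷ R × dot u v ≡ true × countOdd u R ≡ 0
countOdd≡1⇒neighbour u (v ∷ L) eq with dot u v in uv | oddInter≡bit-dot u v
... | true  | p = v , L , refl , uv , suc-injective (subst (λ k → k + countOdd u L ≡ 1) p eq)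
... | false | p with countOdd≡1⇒neighbour u L (subst (λ k → k + countOdd u L ≡ 1) p eq)
... | w , R , q , uw , iso = w , v ∷ R , ↭-trans (prep v q) (swap v w refl) , uw , cong₂ _+_ p iso

countOdd-remove : {x : Subset n} {L R : List (Subset n)} → Isotropic x → L ↭ x ∷ R → countOdd x L ≡ countOdd x R
countOdd-remove {x = x} {R = R} xx p =
  Eq.trans (countOdd-↭ x p) (cong (_+ countOdd x R) (dot≡false⇒oddInter≡0 x x xx))

oddInter≤1 : (x y : Subset n) → oddInter x y ≤ 1
oddInter≤1 x y = m<1+n⇒m≤n (m%n<n ∣ x ∩ y ∣ 2)

sum-map-+ : {A : Set} (f g : A → ℕ) (L : List A) → sum (map (λ x → f x + g x) L) ≡ sum (map f L) + sum (map g L)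
sum-map-+ f g []      = refl
sum-map-+ f g (x ∷ L) = Eq.trans (cong (f x + g x +_) (sum-map-+ f g L)) (interchange (f x) (g x) _ _)
  where
  interchange : ∀ a b c d → a + b + (c + d) ≡ a + c + (b + d)
  interchange = solve-∀

sum-oddInter : (x : Subset n) (L : List (Subset n)) → sum (map (λ y → oddInter y x) L) ≡ countOdd x L
sum-oddInter x []      = refl
sum-oddInter x (y ∷ L) = cong₂ _+_ (oddInter-comm y x) (sum-oddInter x L)

-- Each edge is seen from both ends; isotropy excludes loops, which `countOdd x L` would count as
-- well.
handshake : (L : List (Subset n)) → All Isotropic L → sum (map (λ x → countOdd x L) L) ≡ 2 * op L
handshake []      []         = refl
handshake (x ∷ L) (xx ∷ iso) = begin
  oddInter x x + countOdd x L + sum (map (λ y → oddInter y x + countOdd y L) L)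
    ≡⟨ cong₂ (λ a b → a + countOdd x L + b) (dot≡false⇒oddInter≡0 x x xx) (sum-map-+ (λ y → oddInter y x) _ L) ⟩
  countOdd x L + (sum (map (λ y → oddInter y x) L) + sum (map (λ y → countOdd y L) L))
    ≡⟨ cong₂ (λ a b → countOdd x L + (a + b)) (sum-oddInter x L) (handshake L iso) ⟩
  countOdd x L + (countOdd x L + 2 * op L)
    ≡⟨ double (countOdd x L) (op L) ⟩
  2 * (countOdd x L + op L) ∎
  where
  open ≡-Reasoning
  double : ∀ a b → a + (a + 2 * b) ≡ 2 * (a + b)
  double = solve-∀

-- Reduces a linear inequality to an equation (with slack k) that the ring solver can check.
≤-by : ∀ {a b p q} → p ≤ q → ∀ k → a + q + k ≡ b + p → a ≤ b
≤-by {a} {b} {p} {q} p≤q k eq = +-cancelʳ-≤ q a b (begin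
  a + q     ≤⟨ m≤m+n (a + q) k ⟩
  a + q + k ≡⟨ eq ⟩
  b + p     ≤⟨ +-monoʳ-≤ b p≤q ⟩
  b + q     ∎)
  where open ≤-Reasoning

-- Pigeonhole for the values of a function along a list

module _ {A : Set} (f : A → ℕ) (c : ℕ) where

  pick-small : (L : List A) → sum (map f L) < c * length L → ∃₂ λ x R → L ↭ x ∷ R × f x < c
  pick-small []      lt with () ← subst (0 <_) (*-zeroʳ c) lt
  pick-small (x ∷ L) lt with f x <? c
  ... | yes fx<c = x , L , refl , fx<c
  ... | no  fx≮c with pick-small L (+-cancelˡ-< c _ _ (begin-strict
          c + sum (map f L)   ≤⟨ +-monoˡ-≤ _ (≮⇒≥ fx≮c) ⟩
          f x + sum (map f L) <⟨ lt ⟩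
          c * suc (length L)  ≡⟨ *-suc c (length L) ⟩
          c + c * length L    ∎))
    where open ≤-Reasoning
  ... | y , R , p , fy<c = y , x ∷ R , ↭-trans (prep x p) (swap x y refl) , fy<c

  pick-large : (L : List A) → c * length L < sum (map f L) → ∃₂ λ x R → L ↭ x ∷ R × c < f x
  pick-large []      lt with () ← lt
  pick-large (x ∷ L) lt with c <? f x
  ... | yes c<fx = x , L , refl , c<fx
  ... | no  c≮fx with pick-large L (+-cancelˡ-< c _ _ (begin-strict
          c + c * length L    ≡⟨ sym (*-suc c (length L)) ⟩
          c * suc (length L)  <⟨ lt ⟩
          f x + sum (map f L) ≤⟨ +-monoˡ-≤ _ (≮⇒≥ c≮fx) ⟩
          c + sum (map f L)   ∎))
    where open ≤-Reasoning
  ... | y , R , p , c<fy = y , x ∷ R , ↭-trans (prep x p) (swap x y refl) , c<fy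

module _ {A : Set} (f : A → ℕ) where

  sum-remove : ∀ {L R x} → L ↭ x ∷ R → f x ≡ 0 → sum (map f R) ≡ sum (map f L)
  sum-remove {R = R} p fx≡0 = sym (Eq.trans (sum-↭ (map⁺ f p)) (cong (_+ sum (map f R)) fx≡0))

  -- Removing a first zero keeps the sum and shortens the list by one; the slack of 2 covers both
  -- picks.
  pick-two-zeros : ∀ L → sum (map f L) + 2 ≤ length L →
    ∃₂ λ x y → ∃ λ R → L ↭ x ∷ y ∷ R × f x ≡ 0 × f y ≡ 0
  pick-two-zeros L le with pick-small f 1 L (begin-strict
      sum (map f L)     <⟨ m<m+n _ {2} (s≤s z≤n) ⟩
      sum (map f L) + 2 ≤⟨ le ⟩
      length L          ≡⟨ sym (*-identityˡ _) ⟩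
      1 * length L      ∎)
    where open ≤-Reasoning
  ... | x , R , p , fx<1 with n<1⇒n≡0 fx<1
  ... | fx≡0 with pick-small f 1 R (+-cancelˡ-< 1 _ _ (begin-strict
      1 + sum (map f R) ≡⟨ cong suc (sum-remove p fx≡0) ⟩
      1 + sum (map f L) <⟨ ≤-reflexive (+-comm 2 (sum (map f L))) ⟩
      sum (map f L) + 2 ≤⟨ le ⟩
      length L          ≡⟨ ↭-length p ⟩
      1 + length R      ≡⟨ cong suc (sym (*-identityˡ _)) ⟩
      1 + 1 * length R  ∎))
    where open ≤-Reasoning
  ... | y , Q , q , fy<1 = x , y , Q , ↭-trans p (prep x q) , fx≡0 , n<1⇒n≡0 fy<1

  -- Some value is below 2. If it is 0, removing it lowers twice the length by 2, and the slack of 2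
  -- pays for a second pick.
  pick-two-zeros-or-one : ∀ L → sum (map f L) + 2 < 2 * length L →
    (∃₂ λ x y → ∃ λ R → L ↭ x ∷ y ∷ R × f x ≡ 0 × f y ≡ 0) ⊎ (∃₂ λ x R → L ↭ x ∷ R × f x ≡ 1)
  pick-two-zeros-or-one L lt with pick-small f 2 L (≤-<-trans (m≤m+n _ 2) lt)
  ... | x , R , p , fx<2 with f x in fx≡
  ... | suc (suc _) with s≤s (s≤s ()) ← fx<2
  ... | 1 = inj₂ (x , R , p , fx≡)
  ... | 0 with pick-small f 2 R (+-cancelʳ-< 2 _ _ (begin-strict
      sum (map f R) + 2 ≡⟨ cong (_+ 2) (sum-remove p fx≡) ⟩
      sum (map f L) + 2 <⟨ lt ⟩
      2 * length L      ≡⟨ cong (2 *_) (↭-length p) ⟩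
      2 * suc (length R) ≡⟨ *-suc 2 (length R) ⟩
      2 + 2 * length R  ≡⟨ +-comm 2 _ ⟩
      2 * length R + 2  ∎))
    where open ≤-Reasoning
  ... | y , Q , q , fy<2 with f y in fy≡
  ... | suc (suc _) with s≤s (s≤s ()) ← fy<2
  ... | 1 = inj₂ (y , x ∷ Q , ↭-trans p (↭-trans (prep x q) (swap x y refl)) , fy≡)
  ... | 0 = inj₁ (x , y , Q , ↭-trans p (prep x q) , fx≡ , fy≡)

-- Subquotients and the passage to u^⊥ / u

-- The subquotient P / Z, with its elements represented by members of P
record Space (n : ℕ) : Set₁ where
  field
    P       : Subset n → Set
    Z       : Subset n → Set
    Z?      : ∀ x → Dec (Z x)
    P-⊕     : ∀ {x y} → P x → P y → P (x ⊕ y)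
    P-iso   : ∀ {x} → P x → Isotropic x
    Z-⊕     : ∀ {x y} → Z x → Z y → Z (x ⊕ y)
    radical : ∀ {z x} → Z z → P x → dot z x ≡ false

  -- In characteristic 2 the sum is also the difference, so this means distinct as elements of P /
  -- Z.
  Distinct : List (Subset n) → Set
  Distinct = AllPairs (λ x y → ¬ Z (x ⊕ y))

  Distinct-resp-↭ : ∀ {L M} → L ↭ M → Distinct L → Distinct M
  Distinct-resp-↭ p = PermSetoid.AllPairs-resp-↭ (setoid _)
    (λ {x} {y} ¬z → ¬z ∘ subst Z (⊕-comm y x)) (resp₂ _) (↭⇒↭ₛ p)

dot-⊕-false : (x y z : Subset n) → dot x z ≡ dot y z → dot (x ⊕ y) z ≡ false
dot-⊕-false x y z eq = Eq.trans (dot-⊕ x y z) (Eq.trans (cong (_xor dot y z) eq) (xor-same (dot y z)))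

dot-⊕-false⁻¹ : (x y z : Subset n) → dot (x ⊕ y) z ≡ false → dot x z ≡ dot y z
dot-⊕-false⁻¹ x y z eq = xor≡false⇒≡ (dot x z) (dot y z) (Eq.trans (sym (dot-⊕ x y z)) eq)

-- The subquotient u^⊥ / u: `P` is cut down to the vectors orthogonal to `u`, and `u` joins `Z`. The
-- new `Z` stays orthogonal to the new `P` because `u` is orthogonal to u^⊥.
_/⟨_⟩ : (S : Space n) {u : Subset n} → Space.P S u → Space n
_/⟨_⟩ {n} S {u} Pu = record
  { P       = λ x → P x × dot x u ≡ false
  ; Z       = λ x → Z x ⊎ Z (x ⊕ u)
  ; Z?      = λ x → Z? x ⊎-dec Z? (x ⊕ u)
  ; P-⊕     = λ {x} {y} (Px , xu) (Py , yu) → P-⊕ Px Py , dot-⊕-false x y u (Eq.trans xu (sym yu))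
  ; P-iso   = P-iso ∘ proj₁
  ; Z-⊕     = add
  ; radical = rad
  }
  where
  open Space S
  add : ∀ {x y} → Z x ⊎ Z (x ⊕ u) → Z y ⊎ Z (y ⊕ u) → Z (x ⊕ y) ⊎ Z (x ⊕ y ⊕ u)
  add         (inj₁ p) (inj₁ q) = inj₁ (Z-⊕ p q)
  add {x} {y} (inj₁ p) (inj₂ q) = inj₂ (subst Z (sym (⊕-assoc x y u)) (Z-⊕ p q))
  add {x} {y} (inj₂ p) (inj₁ q) = inj₂ (subst Z (⊕-swapʳ x u y) (Z-⊕ p q))
  add {x} {y} (inj₂ p) (inj₂ q) = inj₁ (subst Z (⊕-cancel-both x y u) (Z-⊕ p q))
  rad : ∀ {z x} → Z z ⊎ Z (z ⊕ u) → P x × dot x u ≡ false → dot z x ≡ false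
  rad         (inj₁ p) (Px , xu) = radical p Px
  rad {z} {x} (inj₂ p) (Px , xu) =
    Eq.trans (dot-⊕-false⁻¹ z u x (radical p Px)) (Eq.trans (dot-comm u x) xu)

-- Bounds the dimension of isotropic subspaces: reducing by u ∉ Z lowers their maximal dimension by one.
RankAtMost : ℕ → Space n → Set
RankAtMost zero    S = ∀ {x} → Space.P S x → Space.Z S x
RankAtMost (suc m) S = ∀ {u} (Pu : Space.P S u) → ¬ Space.Z S u → RankAtMost m (S /⟨ Pu ⟩)

-- Weighted families in a subquotient

module _ (S : Space n) where
  open Space S

  Similar : Subset n → Subset n → Set
  Similar x y = ∀ {z} → P z → dot x z ≡ dot y z

  countOdd-similar : ∀ x y → Similar x y → ∀ {L} → All P L → countOdd x L ≡ countOdd y L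
  countOdd-similar x y s []                = refl
  countOdd-similar x y s {z ∷ _} (Pz ∷ ps) = cong₂ _+_ (oddInter-cong x y z (s Pz)) (countOdd-similar x y s ps)

  countOdd-pointwise : ∀ {x L M} → P x → Pointwise Similar L M → countOdd x L ≡ countOdd x M
  countOdd-pointwise         Px []       = refl
  countOdd-pointwise {x = x} Px (_∷_ {x = y} {y = z} s ss) = cong₂ _+_
    (Eq.trans (oddInter-comm x y) (Eq.trans (oddInter-cong y z x (s Px)) (oddInter-comm z x)))
    (countOdd-pointwise Px ss)

  op-pointwise : ∀ {L M} → All P L → All P M → Pointwise Similar L M → op L ≡ op M
  op-pointwise []       []       []       = refl
  op-pointwise {x ∷ _} {y ∷ _} (p ∷ ps) (q ∷ qs) (s ∷ ss) = cong₂ _+_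
    (Eq.trans (countOdd-similar x y s ps) (countOdd-pointwise q ss)) (op-pointwise ps qs ss)

  -- In `D ++ D ++ M` the entries of `D` have weight 2 and those of `M` weight 1. The two copies of
  -- an isotropic `x` are not adjacent, so only edges to the rest remain, each twice.
  op-double-∷ : ∀ {x} → P x → ∀ D M → op ((x ∷ D) ++ (x ∷ D) ++ M) ≡ 2 * countOdd x (D ++ D ++ M) + op (D ++ D ++ M)
  op-double-∷ {x} Px D M = begin
    op ((x ∷ D) ++ (x ∷ D) ++ M)       ≡⟨ op-↭ (prep x (shift x D (D ++ M))) ⟩
    oddInter x x + countOdd x T + (countOdd x T + op T)
      ≡⟨ cong (λ k → k + countOdd x T + (countOdd x T + op T)) (dot≡false⇒oddInter≡0 x x (P-iso Px)) ⟩
    countOdd x T + (countOdd x T + op T) ≡⟨ arith (countOdd x T) (op T) ⟩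
    2 * countOdd x T + op T ∎
    where
    open ≡-Reasoning
    T = D ++ D ++ M
    arith : ∀ a b → a + (a + b) ≡ 2 * a + b
    arith = solve-∀

  op-double : ∀ {D} → All P D → op (D ++ D ++ []) ≡ 4 * op D
  op-double []                   = refl
  op-double {x ∷ D} (Px ∷ PD) = begin
    op ((x ∷ D) ++ (x ∷ D) ++ [])                            ≡⟨ op-double-∷ Px D [] ⟩
    2 * countOdd x (D ++ D ++ []) + op (D ++ D ++ [])
      ≡⟨ cong₂ (λ a b → 2 * a + b) (Eq.trans (countOdd-++ x D (D ++ [])) (cong (countOdd x D +_) (countOdd-++ x D []))) (op-double PD) ⟩
    2 * (countOdd x D + (countOdd x D + 0)) + 4 * op D       ≡⟨ arith (countOdd x D) (op D) ⟩
    4 * (countOdd x D + op D) ∎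
    where
    open ≡-Reasoning
    arith : ∀ a b → 2 * (a + (a + 0)) + 4 * b ≡ 4 * (a + b)
    arith = solve-∀

  op-double-single : ∀ {D} → All P D → ∀ p → op (D ++ D ++ p ∷ []) ≡ 2 * countOdd p D + 4 * op D
  op-double-single {D} PD p = begin
    op (D ++ D ++ p ∷ [])                           ≡⟨ op-↭ (trans (++⁺ˡ D (shift p D [])) (shift p D (D ++ []))) ⟩
    countOdd p (D ++ D ++ []) + op (D ++ D ++ [])
      ≡⟨ cong₂ _+_ (Eq.trans (countOdd-++ p D (D ++ [])) (cong (countOdd p D +_) (countOdd-++ p D []))) (op-double PD) ⟩
    countOdd p D + (countOdd p D + 0) + 4 * op D    ∎
    where open ≡-Reasoning

  -- The number of edges of a weighted graph is multilinear in the weights, so moving the weight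
  -- of one of two vertices of weight 1 to the other one can be done without increasing it.
  concentrate : ∀ D M → All P (D ++ M) → Distinct (D ++ M) →
    ∃₂ λ D′ M′ → All P (M′ ++ D′) × Distinct (M′ ++ D′) ×
      length M′ ≤ 1 × 2 * length D′ + length M′ ≡ 2 * length D + length M ×
      op (D′ ++ D′ ++ M′) ≤ op (D ++ D ++ M)
  concentrate D []       PL dis =
    D , [] , All-resp-↭ (++-comm D []) PL , Distinct-resp-↭ (++-comm D []) dis , z≤n , refl , ≤-refl
  concentrate D (x ∷ []) PL dis =
    D , x ∷ [] , All-resp-↭ (++-comm D _) PL , Distinct-resp-↭ (++-comm D _) dis , s≤s z≤n , refl , ≤-refl
  concentrate D (x ∷ y ∷ M) PL dis
    with All-resp-↭ perm PL | Distinct-resp-↭ perm dis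
    where
    perm : D ++ x ∷ y ∷ M ↭ x ∷ y ∷ D ++ M
    perm = trans (shift x D (y ∷ M)) (prep x (shift y D M))
  ... | Px ∷ Py ∷ PT | (_ ∷ dx) ∷ dy ∷ dT =
    -- The vertex with fewer edges to the rest `T` takes weight 2 and the other is dropped. Twice
    -- the smaller degree is at most the sum of both, and an edge between `x` and `y` is only lost.
    [ (λ x≤y → descend x Px (Px ∷ PT) (dx ∷ dT) (+-mono-≤ (≤-refl {countOdd x T}) x≤y))
    , (λ y≤x → descend y Py (Py ∷ PT) (dy ∷ dT) (+-mono-≤ y≤x (≤-refl {countOdd y T})))
    ]′ (≤-total (countOdd x T) (countOdd y T))
    where
    T = D ++ D ++ M
    Goal : Set
    Goal = ∃₂ λ D′ M′ → All P (M′ ++ D′) × Distinct (M′ ++ D′) ×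
      length M′ ≤ 1 × 2 * length D′ + length M′ ≡ 2 * length D + length (x ∷ y ∷ M) ×
      op (D′ ++ D′ ++ M′) ≤ op (D ++ D ++ x ∷ y ∷ M)
    perm₂ : D ++ D ++ x ∷ y ∷ M ↭ x ∷ y ∷ T
    perm₂ = trans (++⁺ˡ D (trans (shift x D (y ∷ M)) (prep x (shift y D M))))
              (trans (shift x D (y ∷ D ++ M)) (prep x (shift y D (D ++ M))))
    arith : ∀ a b → 2 * (1 + a) + b ≡ 2 * a + (2 + b)
    arith = solve-∀
    arith₂ : ∀ a b c d → a + b + (c + d) ≡ b + c + d + a
    arith₂ = solve-∀
    open ≤-Reasoning
    descend : ∀ w → P w → All P (w ∷ D ++ M) → Distinct (w ∷ D ++ M) →
      countOdd w T + countOdd w T ≤ countOdd x T + countOdd y T → Goal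
    descend w Pw PL′ dis′ le with concentrate (w ∷ D) M PL′ dis′
    ... | D′ , M′ , PD′ , disD′ , M′≤1 , len , op≤ =
      D′ , M′ , PD′ , disD′ , M′≤1 , Eq.trans len (arith (length D) (length M)) , (begin
        op (D′ ++ D′ ++ M′)                ≤⟨ op≤ ⟩
        op ((w ∷ D) ++ (w ∷ D) ++ M)       ≡⟨ op-double-∷ Pw D M ⟩
        2 * countOdd w T + op T            ≡⟨ cong (λ k → countOdd w T + k + op T) (+-identityʳ (countOdd w T)) ⟩
        countOdd w T + countOdd w T + op T ≤⟨ +-monoˡ-≤ (op T) le ⟩
        countOdd x T + countOdd y T + op T ≤⟨ m≤m+n _ (oddInter x y) ⟩
        countOdd x T + countOdd y T + op T + oddInter x y   ≡⟨ sym (arith₂ (oddInter x y) (countOdd x T) (countOdd y T) (op T)) ⟩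
        op (x ∷ y ∷ T)                     ≡⟨ sym (op-↭ perm₂) ⟩
        op (D ++ D ++ x ∷ y ∷ M)           ∎)

  -- The cases s = 1 and s = 2 inside a subquotient, with K for 2^⌊n/2⌋. The first is doubled
  -- because the induction starts at K = 1, where K/2 is not an integer.
  Supersaturated₁ : ℕ → Set
  Supersaturated₁ K = ∀ {L} → All P L → Distinct L → K + 1 ≤ length L → K ≤ 2 * op L

  Supersaturated₂ : ℕ → Set
  Supersaturated₂ K = ∀ {L} → All P L → Distinct L → K + 2 ≤ length L → K ≤ op L

-- Families contained in u^⊥

module _ (S : Space n) {u : Subset n} (Pu : Space.P S u) where
  open Space S
  private
    S′ = S /⟨ Pu ⟩
    module S′ = Space S′

  -- The family as a weighted set in u^⊥ / u: a coset of u contains at most two members modulo `Z`.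
  -- Cosets met twice are listed in `pairs` (weight 2), those met once in `singles` (weight 1).
  record Splitting (L : List (Subset n)) : Set where
    field
      pairs    : List (Subset n × Subset n)
      singles  : List (Subset n)
      perm     : L ↭ map proj₁ pairs ++ map proj₂ pairs ++ singles
      twins    : All (λ d → Z (proj₁ d ⊕ proj₂ d ⊕ u)) pairs
      distinct : S′.Distinct (map proj₁ pairs ++ singles)

    firsts seconds : List (Subset n)
    firsts  = map proj₁ pairs
    seconds = map proj₂ pairs

    length-split : length L ≡ 2 * length firsts + length singles
    length-split = begin
      length L                                           ≡⟨ ↭-length perm ⟩
      length (firsts ++ seconds ++ singles)              ≡⟨ length-++ firsts ⟩
      length firsts + length (seconds ++ singles)        ≡⟨ cong (length firsts +_) (length-++ seconds) ⟩
      length firsts + (length seconds + length singles)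
        ≡⟨ cong (λ b → length firsts + (b + length singles)) (Eq.trans (length-map proj₂ pairs) (sym (length-map proj₁ pairs))) ⟩
      length firsts + (length firsts + length singles)   ≡⟨ arith (length firsts) (length singles) ⟩
      2 * length firsts + length singles                 ∎
      where
      open ≡-Reasoning
      arith : ∀ a b → a + (a + b) ≡ 2 * a + b
      arith = solve-∀

    module _ (PL : All S′.P L) where
      private
        PL′ = All-resp-↭ perm PL
        PF  = AllP.++⁻ˡ firsts PL′
        PGM = AllP.++⁻ʳ firsts PL′
        PM  = AllP.++⁻ʳ seconds PGM

      all-P : All S′.P (firsts ++ singles)
      all-P = AllP.++⁺ PF PM

      -- Twins differ by `u` modulo `Z`, and `u` is orthogonal to the whole family, so they have the
      -- same neighbours and `seconds` can be replaced by `firsts`.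
      op-split : op L ≡ op (firsts ++ firsts ++ singles)
      op-split = Eq.trans (op-↭ perm) (op-pointwise S′ PL′ (AllP.++⁺ PF all-P)
        (Pointwise.++⁺ (same firsts) (Pointwise.++⁺ (similar pairs twins) (same singles))))
        where
        same : ∀ M → Pointwise (Similar S′) M M
        same M = Pointwise.refl (λ {_} {_} _ → refl)
        similar : ∀ ds → All (λ d → Z (proj₁ d ⊕ proj₂ d ⊕ u)) ds →
          Pointwise (Similar S′) (map proj₂ ds) (map proj₁ ds)
        similar []             []       = []
        similar ((d , e) ∷ ds) (t ∷ ts) =
          (λ {z} P′z → sym (dot-⊕-false⁻¹ d e z (S′.radical (inj₂ t) P′z))) ∷ similar ds ts

  -- Vertices are inserted one by one. A newcomer either pairs up with a single or becomes one; it
  -- cannot meet a complete pair.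
  split : ∀ L → Distinct L → Splitting L
  split []      []        = record { pairs = [] ; singles = [] ; perm = refl ; twins = [] ; distinct = [] }
  split (x ∷ L) (dx ∷ dL) with split L dL
  ... | record { pairs = ds ; singles = M ; perm = perm ; twins = twins ; distinct = distinct }
    with any? (λ y → S′.Z? (x ⊕ y)) M
  ... | no ¬a = record
    { pairs    = ds
    ; singles  = x ∷ M
    ; perm     = trans (prep x perm) (trans (↭-sym (shift x F (G ++ M))) (++⁺ˡ F (↭-sym (shift x G M))))
    ; twins    = twins
    ; distinct = S′.Distinct-resp-↭ (↭-sym (shift x F M)) (AllP.++⁺ (AllP.map⁺ x≉F) (AllP.¬Any⇒All¬ M ¬a) ∷ distinct)
    }
    where
    F = map proj₁ ds
    G = map proj₂ ds
    dx′ = All-resp-↭ perm dx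
    -- If `x` agreed with `d` modulo `Z` and `u`, it would equal `d` or its twin `e` modulo `Z`,
    -- against distinctness.
    x≉F : All (λ d → ¬ S′.Z (x ⊕ proj₁ d)) ds
    x≉F = All.map (λ { {d , e} (t , ¬zd , ¬ze) → λ
        { (inj₁ z) → ¬zd z
        ; (inj₂ z) → ¬ze (subst Z (Eq.trans (⊕-cancel-both (x ⊕ d) (d ⊕ e) u) (⊕-telescope x d e)) (Z-⊕ z t)) } })
      (All.zip (twins , All.zip (AllP.map⁻ (AllP.++⁻ˡ F dx′) , AllP.map⁻ (AllP.++⁻ˡ G (AllP.++⁻ʳ F dx′)))))
  ... | yes a with find a
  ... | y , y∈M , z with ∈-∃++ y∈M
  ... | ys , zs , refl = record
    { pairs    = (y , x) ∷ ds
    ; singles  = ys ++ zs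
    ; perm     = trans (prep x (trans perm (trans (++⁺ˡ F (trans (++⁺ˡ G (shift y ys zs)) (shift y G (ys ++ zs))))
                   (shift y F (G ++ ys ++ zs)))))
                   (trans (swap x y refl) (prep y (↭-sym (shift x F (G ++ ys ++ zs)))))
    ; twins    = twin z ∷ twins
    ; distinct = S′.Distinct-resp-↭ (trans (++⁺ˡ F (shift y ys zs)) (shift y F (ys ++ zs))) distinct
    }
    where
    F = map proj₁ ds
    G = map proj₂ ds
    twin : S′.Z (x ⊕ y) → Z (y ⊕ x ⊕ u)
    twin (inj₁ z) = ⊥-elim (lookup (AllP.++⁻ʳ G (AllP.++⁻ʳ F (All-resp-↭ perm dx))) y∈M z)
    twin (inj₂ z) = subst (λ w → Z (w ⊕ u)) (⊕-comm x y) z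

  module _ {L : List (Subset n)} (PL : All S′.P L) (dL : Distinct L) where

    -- The two cases are the parities of `length L`. With weight 2 on `D` and 1 on `p`, an edge
    -- inside `D` counts four times and an edge at `p` twice.
    concentrated :
      (∃ λ D → All S′.P D × S′.Distinct D × length L ≡ 2 * length D × 4 * op D ≤ op L) ⊎
      (∃₂ λ p D → All S′.P (p ∷ D) × S′.Distinct (p ∷ D) × length L ≡ 2 * length D + 1 ×
        2 * countOdd p D + 4 * op D ≤ op L)
    concentrated with concentrate S′ firsts singles (all-P PL) distinct
      where open Splitting (split L dL)
    ... | D , []         , PD      , dD , _      , lenD , op≤ = inj₁ (D , PD , dD ,
      Eq.trans length-split (Eq.trans (sym lenD) (+-identityʳ _)) ,
      (begin
        4 * op D                         ≡⟨ sym (op-double S′ PD) ⟩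
        op (D ++ D ++ [])                ≤⟨ op≤ ⟩
        op (firsts ++ firsts ++ singles) ≡⟨ sym (op-split PL) ⟩
        op L                             ∎))
      where
      open Splitting (split L dL)
      open ≤-Reasoning
    ... | D , p ∷ []     , Pp ∷ PD , dD , _      , lenD , op≤ = inj₂ (p , D , Pp ∷ PD , dD ,
      Eq.trans length-split (sym lenD) ,
      (begin
        2 * countOdd p D + 4 * op D      ≡⟨ sym (op-double-single S′ PD p) ⟩
        op (D ++ D ++ p ∷ [])            ≤⟨ op≤ ⟩
        op (firsts ++ firsts ++ singles) ≡⟨ sym (op-split PL) ⟩
        op L                             ∎))
      where
      open Splitting (split L dL)
      open ≤-Reasoning
    ... | D , p ∷ q ∷ M  , PD      , dD , s≤s () , lenD , op≤

    module _ {K : ℕ} (sat : Supersaturated₁ S′ K) where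

      private
        doubles : ∀ {D} → All S′.P D → S′.Distinct D → 2 * K < 2 * length D → 2 * K ≤ 4 * op D
        doubles {D} PD dD len = begin
          2 * K          ≤⟨ *-monoʳ-≤ 2 (sat PD dD (subst (_≤ length D) (+-comm 1 K) (*-cancelˡ-< 2 K _ len))) ⟩
          2 * (2 * op D) ≡⟨ sym (*-assoc 2 2 (op D)) ⟩
          4 * op D       ∎
          where open ≤-Reasoning

      reduce₁ : 2 * K + 1 ≤ length L → K ≤ op L
      reduce₁ len with concentrated
      ... | inj₁ (D , PD , dD , lenD , op≤) = begin
        K        ≤⟨ m≤m+n K (K + 0) ⟩
        2 * K    ≤⟨ doubles PD dD (subst (2 * K <_) lenD (subst (_≤ length L) (+-comm (2 * K) 1) len)) ⟩
        4 * op D ≤⟨ op≤ ⟩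
        op L     ∎
        where open ≤-Reasoning
      -- Here `D` may have only K vertices, so `p` is included to reach K + 1. Every edge of `p ∷ D`
      -- has multiplicity at least 2.
      ... | inj₂ (p , D , PD , dD , lenD , op≤) = begin
        K                                        ≤⟨ sat PD dD (subst (_≤ suc (length D)) (+-comm 1 K) (s≤s K≤D)) ⟩
        2 * (countOdd p D + op D)                ≤⟨ m≤m+n _ (2 * op D) ⟩
        2 * (countOdd p D + op D) + 2 * op D     ≡⟨ arith (countOdd p D) (op D) ⟩
        2 * countOdd p D + 4 * op D              ≤⟨ op≤ ⟩
        op L                                     ∎
        where
        open ≤-Reasoning
        arith : ∀ a b → 2 * (a + b) + 2 * b ≡ 2 * a + 4 * b
        arith = solve-∀
        K≤D : K ≤ length D
        K≤D = *-cancelˡ-≤ 2 (+-cancelʳ-≤ 1 (2 * K) (2 * length D) (subst (2 * K + 1 ≤_) lenD len))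

      -- One more vertex than in `reduce₁` gives `D` at least K + 1 elements in either parity, so
      -- `p` can be discarded; the multiplicity 4 turns the bound for s = 1 into 2K edges.
      reduce₂ : 2 * K + 2 ≤ length L → 2 * K ≤ op L
      reduce₂ len with concentrated
      ... | inj₁ (D , PD , dD , lenD , op≤) = ≤-trans (doubles PD dD (begin-strict
        2 * K        <⟨ m<m+n (2 * K) {2} (s≤s z≤n) ⟩
        2 * K + 2    ≤⟨ len ⟩
        length L     ≡⟨ lenD ⟩
        2 * length D ∎)) op≤
        where open ≤-Reasoning
      ... | inj₂ (p , D , _ ∷ PD , _ ∷ dD , lenD , op≤) = begin
        2 * K                       ≤⟨ doubles PD dD (+-cancelʳ-≤ 1 _ _ (begin
          suc (2 * K) + 1           ≡⟨ sym (+-suc (2 * K) 1) ⟩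
          2 * K + 2                 ≤⟨ len ⟩
          length L                  ≡⟨ lenD ⟩
          2 * length D + 1          ∎)) ⟩
        4 * op D                    ≤⟨ m≤n+m _ (2 * countOdd p D) ⟩
        2 * countOdd p D + 4 * op D ≤⟨ op≤ ⟩
        op L                        ∎
        where open ≤-Reasoning

-- Edge counts for families larger than K + 2

module _ (S : Space n) {K : ℕ} (K≥2 : 2 ≤ K) (sat₁ : Supersaturated₁ S K) (sat₂ : Supersaturated₂ S K) where
  open Space S

  -- A bootstrap: deleting any non-isolated vertex shows that there are at least 1 + (K + 2t) edges.
  -- As K ≥ 2, the average degree then exceeds 1, and deleting a vertex of degree at least 2 gives
  -- the full bound.
  supersaturated-grow : ∀ t {L} → All P L → Distinct L → length L ≡ K + 2 + t → K + 2 * t ≤ op L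
  supersaturated-grow zero    PL dL len =
    subst (_≤ _) (sym (+-identityʳ K)) (sat₂ PL dL (≤-reflexive (sym (Eq.trans len (+-identityʳ _)))))
  supersaturated-grow (suc t) {L} PL dL len
    = finish (pick-large deg 1 L (subst₂ _<_ (sym (*-identityˡ _)) (sym hs) many))
    where
    deg = λ x → countOdd x L
    hs : sum (map deg L) ≡ 2 * op L
    hs = handshake L (All.map P-iso PL)
    removed : ∀ {c} → (∃₂ λ x R → L ↭ x ∷ R × c < deg x) → suc c + (K + 2 * t) ≤ op L
    removed {c} (x , R , p , c<) with All-resp-↭ p PL | Distinct-resp-↭ p dL
    ... | Px ∷ PR | _ ∷ dR = begin
      suc c + (K + 2 * t)      ≤⟨ +-mono-≤ (subst (suc c ≤_) (countOdd-remove (P-iso Px) p) c<)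
                                    (supersaturated-grow t PR dR (suc-injective (Eq.trans (sym (↭-length p)) (Eq.trans len (+-suc (K + 2) t))))) ⟩
      countOdd x R + op R      ≡⟨ sym (op-↭ p) ⟩
      op L                     ∎
      where open ≤-Reasoning
    nonempty : 0 < 2 * op L
    nonempty = ≤-trans (≤-trans (s≤s z≤n) K≥2)
      (sat₁ PL dL (subst (K + 1 ≤_) (sym len) (≤-trans (+-monoʳ-≤ K (s≤s z≤n)) (m≤m+n (K + 2) (suc t)))))
    many : length L < 2 * op L
    many = subst (_< 2 * op L) (sym len)
      (≤-by (+-mono-≤ (*-monoʳ-≤ 2 (removed (pick-large deg 0 L (subst (0 <_) (sym hs) nonempty)))) K≥2)
        (3 * t) (arith K t (op L)))
      where
      arith : ∀ K t o → suc (K + 2 + suc t) + (2 * o + K) + 3 * t ≡ 2 * o + (2 * (1 + (K + 2 * t)) + 2)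
      arith = solve-∀
    finish : (∃₂ λ x R → L ↭ x ∷ R × 1 < deg x) → K + 2 * suc t ≤ op L
    finish pk = subst (_≤ op L) (arith K t) (removed pk)
      where
      arith : ∀ K t → 2 + (K + 2 * t) ≡ K + 2 * suc t
      arith = solve-∀

  -- Any two of a, b, c together with the isolated F exceed K vertices, hence span an edge.
  isolated-triangle : ∀ {F a b c} → All P (F ++ a ∷ b ∷ c ∷ []) → Distinct (F ++ a ∷ b ∷ c ∷ []) →
    K ≤ length F + 1 → All (λ x → countOdd x (F ++ a ∷ b ∷ c ∷ []) ≡ 0) F →
    K + 1 ≤ op (a ∷ b ∷ c ∷ [])
  isolated-triangle {F} {a} {b} {c} PW dW len iso
    with All-resp-↭ (++-comm F (a ∷ b ∷ c ∷ [])) PW | Distinct-resp-↭ (++-comm F (a ∷ b ∷ c ∷ [])) dW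
  ... | Pa ∷ Pb ∷ Pc ∷ PF | (ab ∷ ac ∷ aF) ∷ (bc ∷ bF) ∷ cF ∷ dF = begin
    K + 1                                                         ≤⟨ +-monoˡ-≤ 1 K≤2 ⟩
    3                                                             ≤⟨ +-mono-≤ (+-mono-≤ ab≥1 ac≥1) bc≥1 ⟩
    oddInter a b + oddInter a c + oddInter b c                    ≡⟨ arith (oddInter a b) (oddInter a c) (oddInter b c) ⟩
    op (a ∷ b ∷ c ∷ [])                                           ∎
    where
    open ≤-Reasoning
    arith : ∀ p q r → p + q + r ≡ p + (q + 0) + (r + 0 + 0)
    arith = solve-∀
    arith₂ : ∀ p → 2 * (p + 0 + 0) ≡ 2 * p
    arith₂ = solve-∀
    isoF : All (λ x → countOdd x F ≡ 0) F
    isoF = All.map (λ {x} e → m+n≡0⇒m≡0 _ (Eq.trans (sym (countOdd-++ x F _)) e)) iso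
    isoM : All (λ x → All (λ y → oddInter x y ≡ 0) (a ∷ b ∷ c ∷ [])) F
    isoM = All.map (λ {x} e → isolated⇒oddInter≡0 x _ (m+n≡0⇒n≡0 (countOdd x F) (Eq.trans (sym (countOdd-++ x F _)) e))) iso
    isolated : ∀ {y} → y ∈ a ∷ b ∷ c ∷ [] → countOdd y F ≡ 0
    isolated {y} y∈ = oddInter≡0⇒isolated y F (All.map (λ {x} ps → Eq.trans (oddInter-comm y x) (lookup ps y∈)) isoM)
    edge : ∀ {x y} → x ∈ a ∷ b ∷ c ∷ [] → y ∈ a ∷ b ∷ c ∷ [] → All P (x ∷ y ∷ F) → Distinct (x ∷ y ∷ F) → K ≤ 2 * oddInter x y
    edge {x} {y} x∈ y∈ Pxy dxy = begin
      K                     ≤⟨ sat₁ Pxy dxy (≤-trans (+-monoˡ-≤ 1 len) (≤-reflexive (Eq.trans (+-assoc (length F) 1 1) (+-comm (length F) 2)))) ⟩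
      2 * op (x ∷ y ∷ F)    ≡⟨ cong (2 *_) (cong₂ (λ k l → oddInter x y + k + l) (isolated x∈) (cong₂ _+_ (isolated y∈) (op-isolated F isoF))) ⟩
      2 * (oddInter x y + 0 + 0) ≡⟨ arith₂ (oddInter x y) ⟩
      2 * oddInter x y      ∎
    positive : ∀ {x y} → K ≤ 2 * oddInter x y → 1 ≤ oddInter x y
    positive le = *-cancelˡ-≤ 2 (≤-trans K≥2 le)
    ab-edge = edge (here refl) (there (here refl)) (Pa ∷ Pb ∷ PF) ((ab ∷ aF) ∷ bF ∷ dF)
    ab≥1 = positive {a} {b} ab-edge
    ac≥1 = positive {a} {c} (edge (here refl) (there (there (here refl))) (Pa ∷ Pc ∷ PF) ((ac ∷ aF) ∷ cF ∷ dF))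
    bc≥1 = positive {b} {c} (edge (there (here refl)) (there (there (here refl))) (Pb ∷ Pc ∷ PF) ((bc ∷ bF) ∷ cF ∷ dF))
    -- A single edge accounts for the whole bound of case s = 1, which forces K ≤ 2; hence the three
    -- edges of the triangle reach K + 1.
    K≤2 : K ≤ 2
    K≤2 = ≤-trans ab-edge (*-monoʳ-≤ 2 (oddInter≤1 a b))

  -- In the leaf case `length F` stands in for the degree of the deleted vertex `v`. The support has
  -- K + 2 + t vertices with t + |F| ≥ K - 1, so growth alone is enough once t ≥ 1.
  weighted-bound : ∀ F M → All P (F ++ M) → Distinct (F ++ M) → length F < K →
    2 * K + 1 ≤ 2 * length F + length M → 2 * K ≤ length F + op (F ++ F ++ M)
  weighted-bound F M PW dW F<K len with m≤n⇒∃[o]m+o≡n K+2≤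
    where
    arith : ∀ K f m → K + 2 + (2 * f + m + K) + 0 ≡ f + m + (2 * K + 1 + suc f)
    arith = solve-∀
    K+2≤ : K + 2 ≤ length F + length M
    K+2≤ = ≤-by (+-mono-≤ len F<K) 0 (arith K (length F) (length M))
  ... | t , K+2+t≡ with supersaturated-grow t PW dW (Eq.trans (length-++ F) (sym K+2+t≡))
  ... | grown = conclude t K+2+t≡ grown
    where
    f = length F
    m = length M
    conclude : ∀ t → K + 2 + t ≡ f + m → K + 2 * t ≤ op (F ++ M) → 2 * K ≤ f + op (F ++ F ++ M)
    conclude (suc t) K+2+t≡ grown =
      ≤-by (+-mono-≤ (+-mono-≤ len (≤-reflexive (sym K+2+t≡))) (≤-trans grown (op-++-≥ʳ F (F ++ M))))
        t (arith K f m t (op (F ++ F ++ M)))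
      where
      arith : ∀ K f m t o → 2 * K + (2 * f + m + (K + 2 + suc t) + o) + t ≡ f + o + (2 * K + 1 + (f + m) + (K + 2 * suc t))
      arith = solve-∀
    -- For t = 0 one has |F| = K - 1, and growth falls one edge short. Either doubling `F` supplies
    -- that edge, or `F` is isolated and the three vertices of `M` form a triangle.
    conclude zero K+2+t≡ grown with op (F ++ M) <? op (F ++ F ++ M)
    ... | yes lt = ≤-by (+-mono-≤ (+-mono-≤ len (≤-reflexive (sym K+2+t≡))) (≤-trans (s≤s grown) lt))
        0 (arith K f m (op (F ++ F ++ M)))
      where
      arith : ∀ K f m o → 2 * K + (2 * f + m + (K + 2 + 0) + o) + 0 ≡ f + o + (2 * K + 1 + (f + m) + suc (K + 2 * 0))
      arith = solve-∀
    ... | no  ge = triangle M refl m≡3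
      where
      K≤f+1 : K ≤ f + 1
      K≤f+1 = ≤-by (+-mono-≤ len (≤-reflexive (sym K+2+t≡))) 0 (arith K f m)
        where
        arith : ∀ K f m → K + (2 * f + m + (K + 2 + 0)) + 0 ≡ f + 1 + (2 * K + 1 + (f + m))
        arith = solve-∀
      f+1≡K : f + 1 ≡ K
      f+1≡K = ≤-antisym (subst (_≤ K) (+-comm 1 f) F<K) K≤f+1
      m≡3 : m ≡ 3
      m≡3 = +-cancelˡ-≡ f m 3 (Eq.trans (sym K+2+t≡) (Eq.trans (cong (λ k → k + 2 + 0) (sym f+1≡K)) (arith f)))
        where
        arith : ∀ f → f + 1 + 2 + 0 ≡ f + 3
        arith = solve-∀
      triangle : ∀ M′ → M ≡ M′ → length M′ ≡ 3 → 2 * K ≤ f + op (F ++ F ++ M)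
      triangle (a ∷ b ∷ c ∷ []) refl _ = ≤-by
        (+-mono-≤ K≤f+1 (≤-trans (isolated-triangle PW dW K≤f+1 (op-++-≤⇒isolated F (F ++ M) (≮⇒≥ ge)))
          (≤-trans (op-++-≥ʳ F M) (op-++-≥ʳ F (F ++ M)))))
        0 (arith K f (op (F ++ F ++ M)))
        where
        arith : ∀ K f o → 2 * K + (f + 1 + o) + 0 ≡ f + o + (K + (K + 1))
        arith = solve-∀

-- The induction step from K to 2K

module _ (S : Space n) {K : ℕ}
  (sat₁ : ∀ {u} (Pu : Space.P S u) → ¬ Space.Z S u → Supersaturated₁ (S /⟨ Pu ⟩) K) where
  open Space S

  -- The vector `x ⊕ y` is outside `Z` by distinctness, and it is orthogonal to every member since
  -- both summands are.
  isolated-pair : ∀ {L x y R} → All P L → Distinct L → L ↭ x ∷ y ∷ R → countOdd x L ≡ 0 → countOdd y L ≡ 0 →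
    ∃ λ z → Σ (P z) λ Pz → ¬ Z z × All (Space.P (S /⟨ Pz ⟩)) L
  isolated-pair {L} {x} {y} PL dL p x-iso y-iso with All-resp-↭ p PL | Distinct-resp-↭ p dL
  ... | Px ∷ Py ∷ _ | (x≉y ∷ _) ∷ _ = x ⊕ y , P-⊕ Px Py , x≉y , All.zip (PL ,
    All.map (λ {w} (xw , yw) → Eq.trans (dot-comm w (x ⊕ y))
        (dot-⊕-false x y w (Eq.trans (oddInter≡0⇒dot≡false x w xw) (sym (oddInter≡0⇒dot≡false y w yw)))))
      (All.zip (isolated⇒oddInter≡0 x L x-iso , isolated⇒oddInter≡0 y L y-iso)))

  supersaturated₁-step : Supersaturated₁ S (2 * K)
  supersaturated₁-step {L} PL dL len = *-monoʳ-≤ 2 (by-cases (K ≤? op L))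
    where
    deg = λ x → countOdd x L
    arith : ∀ K o → 2 * o + 2 + 2 * K + 1 ≡ 2 * K + 1 + 2 * suc o
    arith = solve-∀
    -- Fewer than K edges give degree sum at most 2K - 2, against at least 2K + 1 vertices: two of
    -- them are isolated.
    few : op L < K → sum (map deg L) + 2 ≤ length L
    few lt = begin
      sum (map deg L) + 2 ≡⟨ cong (_+ 2) (handshake L (All.map P-iso PL)) ⟩
      2 * op L + 2        ≤⟨ ≤-by (*-monoʳ-≤ 2 lt) 1 (arith K (op L)) ⟩
      2 * K + 1           ≤⟨ len ⟩
      length L            ∎
      where open ≤-Reasoning
    reduce : (∃₂ λ x y → ∃ λ R → L ↭ x ∷ y ∷ R × deg x ≡ 0 × deg y ≡ 0) → K ≤ op L
    reduce (x , y , R , p , x-iso , y-iso) with isolated-pair PL dL p x-iso y-iso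
    ... | z , Pz , z∉Z , PL′ = reduce₁ S Pz PL′ dL {K} (sat₁ Pz z∉Z) len
    by-cases : Dec (K ≤ op L) → K ≤ op L
    by-cases (yes le) = le
    by-cases (no  gt) = reduce (pick-two-zeros deg L (few (≰⇒> gt)))

  module _ (sat₂ : ∀ {u} (Pu : Space.P S u) → ¬ Space.Z S u → Supersaturated₂ (S /⟨ Pu ⟩) K) where

    -- Here u is a leaf with neighbour v, and L is what remains after deleting v.
    leaf-bound : ∀ {u v L} (Pu : P u) → P v → dot u v ≡ true → All (Space.P (S /⟨ Pu ⟩)) L → Distinct L →
      1 ≤ countOdd v L → countOdd v L < K → 2 * K + 1 ≤ length L → 2 * K ≤ countOdd v L + op L
    leaf-bound {u} {v} {L} Pu Pv uv PL dL deg>0 deg<K len = begin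
      -- The degree of `v` lies strictly between 0 and K. This yields K ≥ 2 and, through `deg≥`,
      -- fewer than K pairs.
      2 * K                                             ≤⟨ weighted-bound (S /⟨ Pu ⟩) (≤-<-trans deg>0 deg<K) (sat₁ Pu u∉Z) (sat₂ Pu u∉Z) firsts singles
                                                             (all-P PL) distinct (≤-<-trans deg≥ deg<K)
                                                             (subst (2 * K + 1 ≤_) length-split len) ⟩
      length firsts + op (firsts ++ firsts ++ singles)  ≤⟨ +-monoˡ-≤ _ deg≥ ⟩
      countOdd v L + op (firsts ++ firsts ++ singles)   ≡⟨ cong (countOdd v L +_) (sym (op-split PL)) ⟩
      countOdd v L + op L                               ∎
      where
      open ≤-Reasoning
      u∉Z : ¬ Z u
      u∉Z Zu with () ← Eq.trans (sym uv) (radical Zu Pv)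
      open Splitting (split S Pu L dL)
      -- Exactly one of the two members d and d ⊕ u of each pair is adjacent to v.
      one-of-each : ∀ ds → All (λ d → Z (proj₁ d ⊕ proj₂ d ⊕ u)) ds →
        countOdd v (map proj₁ ds) + countOdd v (map proj₂ ds) ≡ length (map proj₁ ds)
      one-of-each []             []       = refl
      one-of-each ((d , e) ∷ ds) (t ∷ ts) = Eq.trans
        (arith (oddInter v d) (countOdd v (map proj₁ ds)) (oddInter v e) (countOdd v (map proj₂ ds)))
        (cong₂ _+_ de (one-of-each ds ts))
        where
        arith : ∀ a b c d → a + b + (c + d) ≡ a + c + (b + d)
        arith = solve-∀
        bits : ∀ a b → a xor b ≡ true → bit a + bit b ≡ 1
        bits false true  _ = refl
        bits true  false _ = refl
        de : oddInter v d + oddInter v e ≡ 1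
        de = Eq.trans
          (cong₂ _+_ (Eq.trans (oddInter-comm v d) (oddInter≡bit-dot d v)) (Eq.trans (oddInter-comm v e) (oddInter≡bit-dot e v)))
          (bits (dot d v) (dot e v) (Eq.trans (sym (dot-⊕ d e v)) (Eq.trans (dot-⊕-false⁻¹ (d ⊕ e) u v (radical t Pv)) uv)))
      deg≥ : length firsts ≤ countOdd v L
      deg≥ = begin
        length firsts                                               ≡⟨ sym (one-of-each pairs twins) ⟩
        countOdd v firsts + countOdd v seconds                      ≤⟨ m≤m+n _ (countOdd v singles) ⟩
        countOdd v firsts + countOdd v seconds + countOdd v singles ≡⟨ +-assoc (countOdd v firsts) _ _ ⟩
        countOdd v firsts + (countOdd v seconds + countOdd v singles)
          ≡⟨ sym (Eq.trans (countOdd-++ v firsts _) (cong (countOdd v firsts +_) (countOdd-++ v seconds singles))) ⟩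
        countOdd v (firsts ++ seconds ++ singles)                   ≡⟨ sym (countOdd-↭ v perm) ⟩
        countOdd v L                                                ∎

    -- Deletes `v`. The leaf `u` stays: it is in u^⊥ by isotropy, and it makes the degree of `v`
    -- positive.
    supersaturated-leaf : ∀ {L u v R} → All P L → Distinct L → L ↭ v ∷ u ∷ R →
      dot u v ≡ true → countOdd u R ≡ 0 → countOdd v L < K → 2 * K + 2 ≤ length L → 2 * K ≤ op L
    supersaturated-leaf {L} {u} {v} {R} PL dL p uv u-iso deg-v len
      with All-resp-↭ p PL | Distinct-resp-↭ p dL
    ... | Pv ∷ Pu ∷ PR | _ ∷ dL′ = subst (2 * K ≤_) (sym (op-↭ p))
      (leaf-bound Pu Pv uv PL′ dL′ (≤-trans (≤-reflexive (sym vu)) (m≤m+n _ (countOdd v R)))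
        (subst (_< K) (countOdd-remove (P-iso Pv) p) deg-v)
        (s≤s⁻¹ (subst₂ _≤_ (+-suc (2 * K) 1) (↭-length p) len)))
      where
      PL′ : All (Space.P (S /⟨ Pu ⟩)) (u ∷ R)
      PL′ = (Pu , P-iso Pu) ∷ All.zip (PR , All.map (λ {w} uw → Eq.trans (dot-comm w u) (oddInter≡0⇒dot≡false u w uw))
                                              (isolated⇒oddInter≡0 u R u-iso))
      vu : oddInter v u ≡ 1
      vu = Eq.trans (oddInter-comm v u) (Eq.trans (oddInter≡bit-dot u v) (cong bit uv))

    supersaturated₂-step : Supersaturated₂ S (2 * K)
    supersaturated₂-step {L} PL dL len = by-cases (2 * K ≤? op L) (any? (λ x → K ≤? deg x) L)
      where
      deg = λ x → countOdd x L
      open ≤-Reasoning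
      large-degree : ∀ {x R} → L ↭ x ∷ R → K ≤ deg x → 2 * K ≤ op L
      large-degree {x} {R} p K≤deg with All-resp-↭ p PL | Distinct-resp-↭ p dL
      ... | Px ∷ PR | _ ∷ dR = begin
        2 * K               ≡⟨ cong (K +_) (+-identityʳ K) ⟩
        K + K               ≤⟨ +-mono-≤ (subst (K ≤_) (countOdd-remove (P-iso Px) p) K≤deg)
                                 (*-cancelˡ-≤ 2 (supersaturated₁-step PR dR
                                   (s≤s⁻¹ (subst₂ _≤_ (+-suc (2 * K) 1) (↭-length p) len)))) ⟩
        countOdd x R + op R ≡⟨ sym (op-↭ p) ⟩
        op L                ∎
      arith : ∀ K o l → suc (2 * o + 2) + (2 * (2 * K) + 2 * l) + 3 ≡ 2 * l + (2 * suc o + 2 * (2 * K + 2))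
      arith = solve-∀
      -- Fewer than 2K edges give degree sum at most 4K - 2, while twice the number of vertices is
      -- at least 4K + 4.
      few : op L < 2 * K → sum (map deg L) + 2 < 2 * length L
      few lt = begin-strict
        sum (map deg L) + 2 ≡⟨ cong (_+ 2) (handshake L (All.map P-iso PL)) ⟩
        2 * op L + 2        <⟨ ≤-by (+-mono-≤ (*-monoʳ-≤ 2 lt) (*-monoʳ-≤ 2 len)) 3 (arith K (op L) (length L)) ⟩
        2 * length L        ∎
      small-degrees : All (λ x → ¬ K ≤ deg x) L →
        (∃₂ λ x y → ∃ λ R → L ↭ x ∷ y ∷ R × deg x ≡ 0 × deg y ≡ 0) ⊎ (∃₂ λ x R → L ↭ x ∷ R × deg x ≡ 1) →
        2 * K ≤ op L
      small-degrees _ (inj₁ (x , y , R , p , x-iso , y-iso)) with isolated-pair PL dL p x-iso y-iso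
      ... | z , Pz , z∉Z , PL′ = reduce₂ S Pz PL′ dL {K} (sat₁ Pz z∉Z) len
      small-degrees small (inj₂ (u , R , p , deg-u))
        with countOdd≡1⇒neighbour u R (Eq.trans (sym (countOdd-remove (P-iso (All.head (All-resp-↭ p PL))) p)) deg-u)
      ... | v , Q , q , uv , u-iso =
        supersaturated-leaf PL dL perm uv u-iso (≰⇒> (All.head (All-resp-↭ perm small))) len
        where
        perm : L ↭ v ∷ u ∷ Q
        perm = ↭-trans p (↭-trans (prep u q) (swap u v refl))
      by-cases : Dec (2 * K ≤ op L) → Dec (Any (λ x → K ≤ deg x) L) → 2 * K ≤ op L
      by-cases (yes le) _ = le
      by-cases (no  gt) (no ¬a) = small-degrees (AllP.¬Any⇒All¬ L ¬a) (pick-two-zeros-or-one deg L (few (≰⇒> gt)))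
      by-cases (no  _)  (yes a) with find a
      ... | x , x∈L , K≤deg with ∈-∃++ x∈L
      ... | ys , zs , refl = large-degree (shift x ys zs) K≤deg

-- The induction on the rank

supersaturated : (m : ℕ) (S : Space n) → RankAtMost m S → Supersaturated₁ S (2 ^ m) × Supersaturated₂ S (2 ^ m)
supersaturated zero    S rank =
  -- At rank 0 all of `P` lies in `Z`, so no two members are distinct and a family of K + 1 = 2
  -- vertices is impossible.
  (λ PL dL len → ⊥-elim (singleton PL dL len)) ,
  (λ PL dL len → ⊥-elim (singleton PL dL (≤-trans (s≤s (s≤s z≤n)) len)))
  where
  open Space S
  singleton : ∀ {L} → All P L → Distinct L → ¬ 2 ≤ length L
  singleton (Px ∷ Py ∷ _) ((x≉y ∷ _) ∷ _) _ = x≉y (rank (P-⊕ Px Py))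
  singleton (Px ∷ []) _ (s≤s ())
supersaturated (suc m) S rank =
  supersaturated₁-step S sat₁ , supersaturated₂-step S sat₁ (λ Pu u∉Z → proj₂ (supersaturated m _ (rank Pu u∉Z)))
  where
  sat₁ : ∀ {u} (Pu : Space.P S u) → ¬ Space.Z S u → Supersaturated₁ (S /⟨ Pu ⟩) (2 ^ m)
  sat₁ Pu u∉Z = proj₁ (supersaturated m _ (rank Pu u∉Z))

-- The rank of the space of even sets

even-space : (n : ℕ) → Space n
even-space n = record
  { P       = Isotropic
  ; Z       = _≡ 𝟎
  ; Z?      = λ x → ≡-dec Bool._≟_ x 𝟎
  ; P-⊕     = λ {x} {y} → iso-⊕ x y
  ; P-iso   = id
  ; Z-⊕     = λ { refl refl → 𝟎⊕𝟎 }
  ; radical = λ { {x = x} refl _ → Eq.trans (dot-comm 𝟎 x) (dot-𝟎 x) }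
  }
  where
  iso-⊕ : (x y : Subset n) → Isotropic x → Isotropic y → Isotropic (x ⊕ y)
  -- The cross terms agree by symmetry, so they cancel in characteristic 2.
  iso-⊕ x y xx yy = dot-⊕-false x y (x ⊕ y) (begin
    dot x (x ⊕ y)          ≡⟨ dot-comm x (x ⊕ y) ⟩
    dot (x ⊕ y) x          ≡⟨ dot-⊕ x y x ⟩
    dot x x xor dot y x    ≡⟨ cong₂ _xor_ (Eq.trans xx (sym yy)) (dot-comm y x) ⟩
    dot y y xor dot x y    ≡⟨ xor-comm (dot y y) (dot x y) ⟩
    dot x y xor dot y y    ≡⟨ sym (dot-⊕ x y y) ⟩
    dot (x ⊕ y) y          ≡⟨ dot-comm (x ⊕ y) y ⟩
    dot y (x ⊕ y)          ∎)
    where open ≡-Reasoning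

-- Non-degeneracy of the form on all of 2^[n]; the witness is the singleton of the first element of
-- `x`.
nonzero-detected : (x : Subset n) → x ≢ 𝟎 → ∃ λ w → dot w x ≡ true
nonzero-detected []          x≢0 = ⊥-elim (x≢0 refl)
nonzero-detected (true ∷ x)  x≢0 = true ∷ 𝟎 , cong not (Eq.trans (dot-comm 𝟎 x) (dot-𝟎 x))
nonzero-detected (false ∷ x) x≢0 with nonzero-detected x (x≢0 ∘ cong (false ∷_))
... | w , wx = false ∷ w , wx

-- Z is j-dimensional and Q is its orthogonal complement in the whole of 2^[n]; z-vec enumerates
-- Z, and q-vec enumerates representatives of the cosets of Q.
record Flag (j : ℕ) (S : Space n) : Set₁ where
  open Space S
  field
    Q      : Subset n → Set
    P⊆Q    : ∀ {x} → P x → Q x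
    Z⊆Q    : ∀ {x} → Z x → Q x
    Q-⊕    : ∀ {x y} → Q x → Q y → Q (x ⊕ y)
    -- The contrapositive of Q^⊥ ⊆ Z. The witness serves as the new coset representative in
    -- `flag-extend`.
    detect : ∀ {x} → ¬ Z x → ∃ λ w → Q w × dot w x ≡ true
    z-vec  : Vec Bool j → Subset n
    z∈Z    : ∀ b → Z (z-vec b)
    z-inj  : ∀ b c → z-vec b ≡ z-vec c → b ≡ c
    q-vec  : Vec Bool j → Subset n
    q-inj  : ∀ b c → Q (q-vec b ⊕ q-vec c) → b ≡ c

  -- Since `Z` lies in `Q`, equal sums have their `q-vec` parts in one coset of `Q`. This fixes `c`,
  -- and then `b`.
  sum-inj : ∀ {b b′ c c′} → z-vec b ⊕ q-vec c ≡ z-vec b′ ⊕ q-vec c′ → b ≡ b′ × c ≡ c′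
  sum-inj {b} {b′} {c} {c′} eq = z-inj b b′ (begin
      z-vec b                         ≡⟨ sym (⊕-cancelʳ (z-vec b) (q-vec c)) ⟩
      z-vec b ⊕ q-vec c ⊕ q-vec c     ≡⟨ cong₂ _⊕_ eq (cong q-vec c≡c′) ⟩
      z-vec b′ ⊕ q-vec c′ ⊕ q-vec c′  ≡⟨ ⊕-cancelʳ (z-vec b′) (q-vec c′) ⟩
      z-vec b′                        ∎) , c≡c′
    where
    open ≡-Reasoning
    q-sum : z-vec b ⊕ z-vec b′ ≡ q-vec c ⊕ q-vec c′
    q-sum = begin
      z-vec b ⊕ z-vec b′                              ≡⟨ cong (_⊕ z-vec b′) (sym (⊕-cancelʳ (z-vec b) (q-vec c))) ⟩
      z-vec b ⊕ q-vec c ⊕ q-vec c ⊕ z-vec b′          ≡⟨ cong (λ v → v ⊕ q-vec c ⊕ z-vec b′) eq ⟩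
      z-vec b′ ⊕ q-vec c′ ⊕ q-vec c ⊕ z-vec b′        ≡⟨ ⊕-comm _ (z-vec b′) ⟩
      z-vec b′ ⊕ (z-vec b′ ⊕ q-vec c′ ⊕ q-vec c)      ≡⟨ cong (z-vec b′ ⊕_) (⊕-assoc (z-vec b′) (q-vec c′) (q-vec c)) ⟩
      z-vec b′ ⊕ (z-vec b′ ⊕ (q-vec c′ ⊕ q-vec c))    ≡⟨ ⊕-cancelˡ (z-vec b′) _ ⟩
      q-vec c′ ⊕ q-vec c                              ≡⟨ ⊕-comm (q-vec c′) (q-vec c) ⟩
      q-vec c ⊕ q-vec c′                              ∎
    c≡c′ : c ≡ c′
    c≡c′ = q-inj c c′ (subst Q q-sum (Z⊆Q (Z-⊕ (z∈Z b) (z∈Z b′))))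

even-flag : (n : ℕ) → Flag 0 (even-space n)
even-flag n = record
  { Q      = λ _ → ⊤
  ; P⊆Q    = λ _ → tt
  ; Z⊆Q    = λ _ → tt
  ; Q-⊕    = λ _ _ → tt
  ; detect = λ {x} x≢0 → proj₁ (nonzero-detected x x≢0) , tt , proj₂ (nonzero-detected x x≢0)
  ; z-vec  = λ _ → 𝟎
  ; z∈Z    = λ _ → refl
  ; z-inj  = λ { [] [] _ → refl }
  ; q-vec  = λ _ → 𝟎
  ; q-inj  = λ { [] [] _ → refl }
  }

adjoin : (u : Subset n) → Bool → Subset n → Subset n
adjoin u false x = x
adjoin u true  x = x ⊕ u

true≢false : ∀ {b} → b ≡ true → b ≢ false
true≢false refl ()

-- Adjoining `u` doubles `Z`, while `Q` shrinks to its intersection with u^⊥. A vector `w` of `Q`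
-- not orthogonal to `u` represents the new coset.
flag-extend : ∀ {j} {S : Space n} → Flag j S → ∀ {u} (Pu : Space.P S u) → ¬ Space.Z S u → Flag (suc j) (S /⟨ Pu ⟩)
flag-extend {n} {j} {S} flag {u} Pu u∉Z = record
  { Q      = Q′
  ; P⊆Q    = λ (Px , xu) → P⊆Q Px , xu
  ; Z⊆Q    = Z′⊆Q′
  ; Q-⊕    = λ {x} {y} (Qx , xu) (Qy , yu) → Q-⊕ Qx Qy , dot-⊕-false x y u (Eq.trans xu (sym yu))
  ; detect = detect′
  ; z-vec  = λ { (b ∷ bs) → adjoin u b (z-vec bs) }
  ; z∈Z    = λ { (false ∷ bs) → inj₁ (z∈Z bs) ; (true ∷ bs) → inj₂ (subst Z (sym (⊕-cancelʳ (z-vec bs) u)) (z∈Z bs)) }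
  ; z-inj  = z-inj′
  ; q-vec  = λ { (b ∷ bs) → adjoin w b (q-vec bs) }
  ; q-inj  = q-inj′
  }
  where
  open Space S
  open Flag flag
  Q′ : Subset n → Set
  Q′ x = Q x × dot x u ≡ false
  w : Subset n
  w = proj₁ (detect u∉Z)
  Qw : Q w
  Qw = proj₁ (proj₂ (detect u∉Z))
  wu : dot w u ≡ true
  wu = proj₂ (proj₂ (detect u∉Z))

  Z′⊆Q′ : ∀ {x} → Z x ⊎ Z (x ⊕ u) → Q′ x
  Z′⊆Q′     (inj₁ z) = Z⊆Q z , radical z Pu
  Z′⊆Q′ {x} (inj₂ z) = subst Q (⊕-cancelʳ x u) (Q-⊕ (Z⊆Q z) (P⊆Q Pu)) ,
    Eq.trans (dot-⊕-false⁻¹ x u u (radical z Pu)) (P-iso Pu)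

  -- Take `a` detecting `x` and `b` detecting `x ⊕ u`. One of `a`, `b`, `a ⊕ b` is orthogonal to `u`
  -- and still detects `x`.
  detect′ : ∀ {x} → ¬ (Z x ⊎ Z (x ⊕ u)) → ∃ λ w → Q′ w × dot w x ≡ true
  detect′ {x} x∉Z′ with detect (x∉Z′ ∘ inj₁) | detect (x∉Z′ ∘ inj₂)
  ... | a , Qa , ax | b , Qb , bxu with dot a u in au | dot b u in bu
  ... | false | _     = a , (Qa , au) , ax
  ... | true  | false = b , (Qb , bu) , (begin
      dot b x                ≡⟨ sym (xor-identityʳ (dot b x)) ⟩
      dot b x xor false      ≡⟨ cong (dot b x xor_) (sym bu) ⟩
      dot b x xor dot b u    ≡⟨ cong₂ _xor_ (dot-comm b x) (dot-comm b u) ⟩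
      dot x b xor dot u b    ≡⟨ sym (dot-⊕ x u b) ⟩
      dot (x ⊕ u) b          ≡⟨ dot-comm (x ⊕ u) b ⟩
      dot b (x ⊕ u)          ≡⟨ bxu ⟩
      true                   ∎)
      where open ≡-Reasoning
  ... | true  | true  = a ⊕ b , (Q-⊕ Qa Qb , dot-⊕-false a b u (Eq.trans au (sym bu))) , (begin
      dot (a ⊕ b) x          ≡⟨ dot-⊕ a b x ⟩
      dot a x xor dot b x    ≡⟨ cong (_xor dot b x) (Eq.trans ax (sym bu)) ⟩
      dot b u xor dot b x    ≡⟨ xor-comm (dot b u) (dot b x) ⟩
      dot b x xor dot b u    ≡⟨ cong₂ _xor_ (dot-comm b x) (dot-comm b u) ⟩
      dot x b xor dot u b    ≡⟨ sym (dot-⊕ x u b) ⟩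
      dot (x ⊕ u) b          ≡⟨ dot-comm (x ⊕ u) b ⟩
      dot b (x ⊕ u)          ≡⟨ bxu ⟩
      true                   ∎)
      where open ≡-Reasoning

  u≢z⊕z : ∀ bs cs → z-vec bs ⊕ u ≢ z-vec cs
  u≢z⊕z bs cs eq = u∉Z (subst Z
    (Eq.trans (cong (z-vec bs ⊕_) (sym eq)) (⊕-cancelˡ (z-vec bs) u)) (Z-⊕ (z∈Z bs) (z∈Z cs)))

  z-inj′ : ∀ b c → _ → b ≡ c
  z-inj′ (false ∷ bs) (false ∷ cs) eq = cong (false ∷_) (z-inj bs cs eq)
  z-inj′ (false ∷ bs) (true ∷ cs)  eq = ⊥-elim (u≢z⊕z cs bs (sym eq))
  z-inj′ (true ∷ bs)  (false ∷ cs) eq = ⊥-elim (u≢z⊕z bs cs eq)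
  z-inj′ (true ∷ bs)  (true ∷ cs)  eq = cong (true ∷_) (z-inj bs cs
    (Eq.trans (sym (⊕-cancelʳ (z-vec bs) u)) (Eq.trans (cong (_⊕ u) eq) (⊕-cancelʳ (z-vec cs) u))))

  -- As `w` is in `Q`, the two representatives would coincide, leaving `w` itself orthogonal to `u`.
  ¬q⊕q⊕w : ∀ bs cs → ¬ Q′ (q-vec bs ⊕ q-vec cs ⊕ w)
  ¬q⊕q⊕w bs cs (q , qu) with q-inj bs cs (subst Q (⊕-cancelʳ _ w) (Q-⊕ q Qw))
  ... | refl = true≢false wu (Eq.trans (cong (λ v → dot v u) (sym w≡)) qu)
    where
    w≡ : q-vec bs ⊕ q-vec bs ⊕ w ≡ w
    w≡ = Eq.trans (⊕-assoc _ _ w) (⊕-cancelˡ (q-vec bs) w)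

  q-inj′ : ∀ b c → _ → b ≡ c
  q-inj′ (false ∷ bs) (false ∷ cs) (q , _) = cong (false ∷_) (q-inj bs cs q)
  q-inj′ (false ∷ bs) (true ∷ cs)  q       = ⊥-elim (¬q⊕q⊕w bs cs (subst Q′ (sym (⊕-assoc (q-vec bs) (q-vec cs) w)) q))
  q-inj′ (true ∷ bs)  (false ∷ cs) q       = ⊥-elim (¬q⊕q⊕w bs cs (subst Q′ (⊕-swapʳ (q-vec bs) w (q-vec cs)) q))
  q-inj′ (true ∷ bs)  (true ∷ cs)  (q , _) = cong (true ∷_) (q-inj bs cs (subst Q (⊕-cancel-both (q-vec bs) (q-vec cs) w) q))

-- Counting vectors to bound the length of a flag

encode : Vec Bool n → Fin (2 ^ n)
encode []       = Fin.zero
encode (b ∷ bs) = combine (Inverse.from 2↔Bool b) (encode bs)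

encode-injective : (x y : Vec Bool n) → encode x ≡ encode y → x ≡ y
encode-injective []       []       _  = refl
encode-injective (a ∷ x) (b ∷ y) eq with combine-injective (Inverse.from 2↔Bool a) (encode x) (Inverse.from 2↔Bool b) (encode y) eq
... | p , q = cong₂ _∷_ (Injection.injective (↔⇒↣ (↔-sym 2↔Bool)) p) (encode-injective x y q)

decode : ∀ n → Fin (2 ^ n) → Vec Bool n
decode zero    _ = []
decode (suc n) i = Inverse.to 2↔Bool (proj₁ (remQuot {2} (2 ^ n) i)) ∷ decode n (proj₂ (remQuot {2} (2 ^ n) i))

remQuot-injective : ∀ {m} k (i j : Fin (m * k)) →
  proj₁ (remQuot {m} k i) ≡ proj₁ (remQuot {m} k j) → proj₂ (remQuot {m} k i) ≡ proj₂ (remQuot {m} k j) → i ≡ j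
remQuot-injective {m} k i j p q =
  Eq.trans (sym (combine-remQuot {m} k i)) (Eq.trans (cong₂ combine p q) (combine-remQuot {m} k j))

decode-injective : ∀ n (i j : Fin (2 ^ n)) → decode n i ≡ decode n j → i ≡ j
decode-injective zero    Fin.zero Fin.zero _ = refl
decode-injective (suc n) i j eq with ∷-injective eq
... | p , q = remQuot-injective {2} (2 ^ n) i j (Injection.injective (↔⇒↣ 2↔Bool) p) (decode-injective n _ _ q)

-- The sums `z-vec b ⊕ q-vec c` are 2^j * 2^j different subsets of [n].
flag-dimension : ∀ {j} {S : Space n} → Flag j S → j + j ≤ n
flag-dimension {n} {j} flag = ≮⇒≥ λ n<2j → <⇒≱ (^-monoʳ-< 2 (s≤s (s≤s z≤n)) n<2j)
  (subst (_≤ 2 ^ n) (sym (^-distribˡ-+-* 2 j j)) (injective⇒≤ {f = f} f-inj))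
  where
  open Flag flag
  f : Fin (2 ^ j * 2 ^ j) → Fin (2 ^ n)
  f i = encode (z-vec (decode j (proj₁ (remQuot {2 ^ j} (2 ^ j) i))) ⊕ q-vec (decode j (proj₂ (remQuot {2 ^ j} (2 ^ j) i))))
  f-inj : ∀ {i i′} → f i ≡ f i′ → i ≡ i′
  f-inj {i} {i′} eq with sum-inj (encode-injective _ _ eq)
  ... | p , q = remQuot-injective {2 ^ j} (2 ^ j) i i′ (decode-injective j _ _ p) (decode-injective j _ _ q)

n<2+2⌊n/2⌋ : ∀ n → n < suc (n / 2) + suc (n / 2)
n<2+2⌊n/2⌋ n = begin-strict
  n                           ≡⟨ m≡m%n+[m/n]*n n 2 ⟩
  n % 2 + n / 2 * 2           <⟨ +-monoˡ-< (n / 2 * 2) (m%n<n n 2) ⟩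
  2 + n / 2 * 2               ≡⟨ arith (n / 2) ⟩
  suc (n / 2) + suc (n / 2)   ∎
  where
  open ≤-Reasoning
  arith : ∀ h → 2 + h * 2 ≡ suc h + suc h
  arith = solve-∀

-- A member of `P` outside `Z` after ⌊n/2⌋ extensions would permit one more, and 2(⌊n/2⌋ + 1)
-- exceeds n.
flag-rank : ∀ m {j} {S : Space n} → Flag j S → j + m ≡ n / 2 → RankAtMost m S
flag-rank {n} zero {j} {S} flag eq {x} Px with Space.Z? S x
... | yes x∈Z = x∈Z
... | no  x∉Z = ⊥-elim (<⇒≱ (n<2+2⌊n/2⌋ n)
  (subst (λ h → suc h + suc h ≤ n) (Eq.trans (sym (+-identityʳ j)) eq) (flag-dimension (flag-extend flag Px x∉Z))))
flag-rank (suc m) {j} flag eq Pu u∉Z = flag-rank m (flag-extend flag Pu u∉Z) (Eq.trans (sym (+-suc j m)) eq)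

even-supersaturated : (n : ℕ) → Supersaturated₁ (even-space n) (2 ^ (n / 2)) × Supersaturated₂ (even-space n) (2 ^ (n / 2))
even-supersaturated n = supersaturated (n / 2) (even-space n) (flag-rank (n / 2) (even-flag n) refl)

-- The bound is doubled so that the exponent ⌊n/2⌋ - 1, negative for n = 1, is never truncated.
theorem1 : (n : ℕ) → 1 ≤ n → (s : ℕ) → (s ≡ 1 ⊎ s ≡ 2) →
    (𝒜 : List (Subset n)) → Unique 𝒜 → All EvenSize 𝒜 →
    2 ^ (n / 2) + s ≤ length 𝒜 →
    s * 2 ^ (n / 2) ≤ 2 * op 𝒜
theorem1 n _ s s≡ 𝒜 unique even len = cases s≡
  where
  iso : All Isotropic 𝒜
  iso = All.map (λ {x} → evenSize⇒isotropic x) even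
  distinct : Space.Distinct (even-space n) 𝒜
  distinct = AllPairs.map (λ {x} {y} x≢y → x≢y ∘ ⊕≡𝟎⇒≡ x y) unique
  cases : s ≡ 1 ⊎ s ≡ 2 → s * 2 ^ (n / 2) ≤ 2 * op 𝒜
  cases (inj₁ refl) = subst (_≤ 2 * op 𝒜) (sym (*-identityˡ _)) (proj₁ (even-supersaturated n) iso distinct len)
  cases (inj₂ refl) = *-monoʳ-≤ 2 (proj₂ (even-supersaturated n) iso distinct len)
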